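{- For $n=o(2^T)$, any deterministic algorithm that achieves regret $R$ for the discrete prediction with experts problem with $n$ experts and $T$ days must use $\Omega\left(\frac{nM}{RT}\right)$ space when the best expert makes $M$ mistakes.
   Context: Discrete prediction with experts problem (streaming). There are $n$ experts and $T$ days. On each day $t\in[T]$, the algorithm first receives the predictions of all $n$ experts (elements of a fixed finite set, e.g. $\{0,1\}$), then outputs its own prediction for that day, and then the correct outcome of day $t$ is revealed. A prediction (by an expert or by the algorithm) costs $0$ if it equals the outcome and $1$ otherwise (a mistake). The number of mistakes of the best expert is the minimum over experts of the total number of mistakes made over the $T$ days; it is denoted $M$. Regret is amortized over days: the algorithm achieves regret $R$ if its total number of mistakes exceeds that of the best expert by at most $RT$. The space of the algorithm is the number of bits of memory it keeps while processing the stream of days. A deterministic algorithm must achieve the regret guarantee on every input stream.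
   Formalization: Adds n ≥ 2 and M + RT < T; otherwise false: with R = 1, M = 1, n = 2^(T/2), a memoryless algorithm has regret 1; with n = 1, copying the expert needs no space. R is rational (no loss); the day number counts as memory; regret is needed only when the best expert makes at most M mistakes. -}

module Defs where

open import Data.Bool using (Bool; if_then_else_)
open import Data.Fin using (Fin; _≟_)
open import Data.Integer using (+_)
open import Data.List using (allFin; map)
open import Data.List.Extrema.Nat using (min)
open import Data.Nat using (ℕ; _+_; _*_; _≤_)
open import Data.Product using (Σ-syntax; _×_; _,_)
open import Data.Rational as ℚ using (ℚ)
open import Data.Vec using (Vec; []; _∷_; lookup)
open import Relation.Nullary using (does)

ι : ℕ → ℚ
ι m = + m ℚ./ 1

-- f = o(g): the factor k plays the role of 1/ε.
_∈o_ : (ℕ → ℕ) → (ℕ → ℕ) → Set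
f ∈o g = ∀ k → Σ[ t₀ ∈ ℕ ] (∀ t → t₀ ≤ t → k * f t ≤ g t)

-- One day: the predictions of the n experts and the outcome, all taken from
-- the q-element set Fin q.
Day : ℕ → ℕ → Set
Day q n = Vec (Fin q) n × Fin q

Stream : ℕ → ℕ → ℕ → Set
Stream q n T = Vec (Day q n) T

-- A deterministic algorithm with s bits of memory.  Only what is retained from
-- one day to the next is charged; work within a day is free.  The current day
-- number is not supplied, so an algorithm that needs it must store it.
record Algorithm (q n s : ℕ) : Set where
  field
    start   : Vec Bool s
    predict : Vec Bool s → Vec (Fin q) n → Fin q
    update  : Vec Bool s → Vec (Fin q) n → Fin q → Vec Bool s

cost : ∀ {q} → Fin q → Fin q → ℕ
cost prediction outcome = if does (prediction ≟ outcome) then 0 else 1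

expertMistakes : ∀ {q n T} → Stream q n T → Fin n → ℕ
expertMistakes []               i = 0
expertMistakes ((x , o) ∷ days) i = cost (lookup x i) o + expertMistakes days i

-- No expert makes more than T mistakes, so for n ≥ 1 the default value T does
-- not affect the minimum.
bestMistakes : ∀ {q n T} → Stream q n T → ℕ
bestMistakes {n = n} {T} σ = min T (map (expertMistakes σ) (allFin n))

module _ {q n s : ℕ} (A : Algorithm q n s) where
  open Algorithm A

  mistakesFrom : ∀ {T} → Vec Bool s → Stream q n T → ℕ
  mistakesFrom m []               = 0
  mistakesFrom m ((x , o) ∷ days) =
    cost (predict m x) o + mistakesFrom (update m x o) days

  mistakes : ∀ {T} → Stream q n T → ℕ
  mistakes = mistakesFrom start

  -- Regret R (amortized over T days) on every stream whose best expert makes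
  -- at most M mistakes.  M is an upper bound because the Ω(nM/(RT)) lower bound
  -- fails if only streams with exactly M mistakes count: always contradicting
  -- expert 0 over {0,1} takes no memory and errs at most T - M times on those,
  -- which is regret 1 - 2M/T.
  AchievesRegret : (T M : ℕ) → ℚ → Set
  AchievesRegret T M R =
    ∀ (σ : Stream q n T) → bestMistakes σ ≤ M →
    ι (mistakes σ) ℚ.≤ ι (bestMistakes σ) ℚ.+ R ℚ.* ι T

{-# OPTIONS --safe #-}
-- Split the experts into k = ⌊n/3⌋ blocks of three and let v ∈ 3^k choose one expert
-- per block.  In a fixed memory state, the algorithm's predictor can avoid erring
-- whenever the chosen experts make at most s mistakes in total only if v lies in a
-- family whose members pairwise agree in more than s blocks; such a family has at most
-- 3^k / 2^(s+1) members.  Hence by a union bound over the 2^s states a single v works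
-- for all of them, and from then on the adversary makes the algorithm err every day
-- while the k chosen experts together err at most s times a day.  After t = ⌊kM/s⌋ days
-- the best expert has at most M, and at most st/k, mistakes; if 2s ≤ k this is at most
-- t/2, so RT ≥ t/2.  If k < 2s, two experts who always disagree give RT ≥ M, which
-- suffices.
module Submission where

open import Defs
open import Data.Bool using (Bool; true; false; if_then_else_)
open import Data.Fin using (Fin; zero; suc; _≟_; _↑ˡ_; _↑ʳ_)
open import Data.Integer using (+_)
import Data.Integer as ℤ
import Data.Integer.Properties as ℤ
open import Data.List using (List; []; _∷_; _++_; map; length; allFin; cartesianProductWith)
open import Data.List.Extrema.Nat using (min≤xs)
open import Data.List.Membership.Propositional using (_∈_; find; lose)
open import Data.List.Membership.Propositional.Properties
  using (∈-allFin; ∈-map⁺; ∈-cartesianProductWith⁺)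
open import Data.List.Properties using (length-++; length-map; map-++; map-∘)
open import Data.List.Relation.Unary.All as All using ()
open import Data.List.Relation.Unary.Any using (Any; here; there; any?)
open import Data.Nat using (ℕ; zero; suc; _+_; _*_; _∸_; _^_; _≤_; _<_; z≤n; s≤s; _≤?_;
  _<?_; s≤s⁻¹; s<s⁻¹; NonZero; >-nonZero; >-nonZero⁻¹; ≢-nonZero)
open import Data.Nat.Coprimality using (1-coprimeTo) renaming (sym to coprime-sym)
open import Data.Nat.DivMod using (_/_; _%_; m≡m%n+[m/n]*n; m%n<n; m/n*n≤m; m≥n⇒m/n>0)
open import Data.Nat.ListAction using (sum)
open import Data.Nat.ListAction.Properties using (sum-++)
open import Data.Nat.Properties hiding (_≟_)
open import Data.Nat.Tactic.RingSolver using (solve-∀)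
open import Data.Product using (Σ-syntax; ∃-syntax; _×_; _,_; proj₁; proj₂)
open import Data.Rational as ℚ using (ℚ; 0ℚ)
import Data.Rational.Properties as ℚ
open import Data.Sum using (_⊎_; inj₁; inj₂; [_,_]′)
open import Data.Vec using (Vec; []; _∷_; lookup; replicate)
open import Data.Vec.Properties using (lookup-replicate)
open import Function using (_∘_; const; it)
open import Relation.Binary.PropositionalEquality
  using (_≡_; _≢_; refl; cong; cong₂; sym; trans; subst)
open import Relation.Nullary using (Dec; yes; no; does; ¬_; contradiction)
open import Relation.Nullary.Decidable using (¬?; _×-dec_; _⊎-dec_; decidable-stable)

private variable
  A B : Set

-- Finite sums

∑ : List A → (A → ℕ) → ℕ
∑ xs f = sum (map f xs)

∑-cong : ∀ (xs : List A) {f g} → (∀ x → f x ≡ g x) → ∑ xs f ≡ ∑ xs g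
∑-cong []       f≡g = refl
∑-cong (x ∷ xs) f≡g = cong₂ _+_ (f≡g x) (∑-cong xs f≡g)

∑-zero : ∀ (xs : List A) → ∑ xs (const 0) ≡ 0
∑-zero []       = refl
∑-zero (_ ∷ xs) = ∑-zero xs

∑-+ : ∀ (xs : List A) f g → ∑ xs (λ x → f x + g x) ≡ ∑ xs f + ∑ xs g
∑-+ []       f g = refl
∑-+ (x ∷ xs) f g rewrite ∑-+ xs f g = interchange (f x) (g x) (∑ xs f) (∑ xs g)
  where
  interchange : ∀ a b c d → a + b + (c + d) ≡ a + c + (b + d)
  interchange = solve-∀

∑-*ˡ : ∀ c (xs : List A) f → ∑ xs (λ x → c * f x) ≡ c * ∑ xs f
∑-*ˡ c []       f = sym (*-zeroʳ c)
∑-*ˡ c (x ∷ xs) f rewrite ∑-*ˡ c xs f = sym (*-distribˡ-+ c (f x) (∑ xs f))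

∑-swap : ∀ (xs : List A) (ys : List B) (f : A → B → ℕ) →
         ∑ xs (λ x → ∑ ys (f x)) ≡ ∑ ys (λ y → ∑ xs (λ x → f x y))
∑-swap []       ys f = sym (∑-zero ys)
∑-swap (x ∷ xs) ys f rewrite ∑-swap xs ys f =
  sym (∑-+ ys (f x) (λ y → ∑ xs (λ x → f x y)))

∑≤length* : ∀ (xs : List A) {f c} → (∀ x → f x ≤ c) → ∑ xs f ≤ length xs * c
∑≤length* []       f≤c = z≤n
∑≤length* (x ∷ xs) f≤c = +-mono-≤ (f≤c x) (∑≤length* xs f≤c)

length*≤∑ : ∀ (xs : List A) {f c} → (∀ x → c ≤ f x) → length xs * c ≤ ∑ xs f
length*≤∑ []       c≤f = z≤n
length*≤∑ (x ∷ xs) c≤f = +-mono-≤ (c≤f x) (length*≤∑ xs c≤f)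

∑≡0⇒≡0 : ∀ {xs : List A} f {x} → ∑ xs f ≡ 0 → x ∈ xs → f x ≡ 0
∑≡0⇒≡0 {xs = y ∷ _} f eq (here refl) = m+n≡0⇒m≡0 (f y) eq
∑≡0⇒≡0 {xs = y ∷ _} f eq (there x∈)  = ∑≡0⇒≡0 f (m+n≡0⇒n≡0 (f y) eq) x∈

-- Pigeonhole: dropping a nonzero summand lowers the length by one and the sum by at least one, so
-- the strict inequality survives.
∑<length⇒∃≡0 : ∀ (xs : List A) f → ∑ xs f < length xs → ∃[ x ] f x ≡ 0
∑<length⇒∃≡0 (x ∷ xs) f lt with f x in eq
... | zero  = x , eq
... | suc a = ∑<length⇒∃≡0 xs f (≤-<-trans (m≤n+m (∑ xs f) a) (s<s⁻¹ lt))

∑-++ : ∀ (xs ys : List A) f → ∑ (xs ++ ys) f ≡ ∑ xs f + ∑ ys f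
∑-++ xs ys f = trans (cong sum (map-++ f xs ys)) (sum-++ (map f xs) (map f ys))

∑-map : ∀ (xs : List A) (h : A → B) f → ∑ (map h xs) f ≡ ∑ xs (f ∘ h)
∑-map xs h f = cong sum (sym (map-∘ xs))

-- Enumeration of vectors

vecs : List A → ∀ k → List (Vec A k)
vecs xs zero    = [] ∷ []
vecs xs (suc k) = cartesianProductWith _∷_ xs (vecs xs k)

∈-vecs : ∀ {xs : List A} → (∀ x → x ∈ xs) → ∀ {k} (v : Vec A k) → v ∈ vecs xs k
∈-vecs ∈xs []      = here refl
∈-vecs ∈xs (x ∷ v) = ∈-cartesianProductWith⁺ _∷_ (∈xs x) (∈-vecs ∈xs v)

length-vecs : ∀ (xs : List A) k → length (vecs xs k) ≡ length xs ^ k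
length-vecs xs zero    = refl
length-vecs xs (suc k) = trans (go xs) (cong (length xs *_) (length-vecs xs k))
  where
  go : ∀ ys → length (cartesianProductWith _∷_ ys (vecs xs k)) ≡ length ys * length (vecs xs k)
  go []       = refl
  go (y ∷ ys) = trans (length-++ (map (y ∷_) (vecs xs k)))
                      (cong₂ _+_ (length-map (y ∷_) (vecs xs k)) (go ys))

∑-vecs : ∀ (xs : List A) k f →
         ∑ (vecs xs (suc k)) f ≡ ∑ xs (λ x → ∑ (vecs xs k) (λ v → f (x ∷ v)))
∑-vecs xs k f = go xs
  where
  go : ∀ ys → ∑ (cartesianProductWith _∷_ ys (vecs xs k)) f ≡
              ∑ ys (λ y → ∑ (vecs xs k) (λ v → f (y ∷ v)))
  go []       = refl
  go (y ∷ ys) = trans (∑-++ (map (y ∷_) (vecs xs k)) _ f)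
                      (cong₂ _+_ (∑-map (vecs xs k) (y ∷_) f) (go ys))

-- A product inequality for families that agree in many coordinates

match : ∀ {a} → Fin a → Fin a → ℕ
match x y = if does (x ≟ y) then 1 else 0

agreements : ∀ {a k} → Vec (Fin a) k → Vec (Fin a) k → ℕ
agreements []      []      = 0
agreements (x ∷ v) (y ∷ w) = match x y + agreements v w

-- With Q = x y, the bounds on x Y and X y give Q X Y ≤ 4 P², so the claim times Q
-- reduces to Q² + 4 P Q + 4 P² ≤ 9 P Q, that is (Q - P) (Q - 4 P) ≤ 0.
heavy-diagonal : ∀ x X y Y {P} → P < x * y → x * y ≤ 4 * P → x * Y ≤ 2 * P → X * y ≤ 2 * P →
                 (x + X) * (y + Y) ≤ 9 * P
heavy-diagonal x X y Y {P} P<Q Q≤4P xY≤ Xy≤ = *-cancelˡ-≤ Q {{Q≢0}} (begin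
  Q * ((x + X) * (y + Y))                          ≡⟨ expand x X y Y ⟩
  Q * Q + Q * (x * Y + X * y) + x * Y * (X * y)    ≤⟨ +-mono-≤ (+-monoʳ-≤ (Q * Q) (*-monoʳ-≤ Q (+-mono-≤ xY≤ Xy≤))) (*-mono-≤ xY≤ Xy≤) ⟩
  Q * Q + Q * (2 * P + 2 * P) + 2 * P * (2 * P)    ≡⟨ cong (λ Q → Q * Q + Q * (2 * P + 2 * P) + 2 * P * (2 * P)) P+e≡Q ⟨
  (P + e) * (P + e) + (P + e) * (2 * P + 2 * P) + 2 * P * (2 * P) ≡⟨ lhs P e ⟩
  e * e + (9 * P * P + 6 * P * e)                  ≤⟨ +-monoˡ-≤ _ (*-monoˡ-≤ e e≤3P) ⟩
  3 * P * e + (9 * P * P + 6 * P * e)              ≡⟨ rhs P e ⟩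
  (P + e) * (9 * P)                                ≡⟨ cong (_* (9 * P)) P+e≡Q ⟩
  Q * (9 * P)                                      ∎)
  where
  open ≤-Reasoning
  Q = x * y
  e = Q ∸ P
  P+e≡Q : P + e ≡ Q
  P+e≡Q = m+[n∸m]≡n (<⇒≤ P<Q)
  Q≢0 : NonZero Q
  Q≢0 = >-nonZero (≤-<-trans z≤n P<Q)
  e≤3P : e ≤ 3 * P
  e≤3P = +-cancelˡ-≤ P e (3 * P) (≤-trans (≤-reflexive P+e≡Q) Q≤4P)
  expand : ∀ x X y Y → x * y * ((x + X) * (y + Y)) ≡
           x * y * (x * y) + x * y * (x * Y + X * y) + x * Y * (X * y)
  expand = solve-∀
  lhs : ∀ P e → (P + e) * (P + e) + (P + e) * (2 * P + 2 * P) + 2 * P * (2 * P) ≡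
        e * e + (9 * P * P + 6 * P * e)
  lhs = solve-∀
  rhs : ∀ P e → 3 * P * e + (9 * P * P + 6 * P * e) ≡ (P + e) * (9 * P)
  rhs = solve-∀

-- The weight 4 = (3 - 1)² is the largest one for which the bound 9 P holds.
ternary-inequality : ∀ (f g : Fin 3 → ℕ) P → (∀ i j → f i * g j ≤ 4 ^ match i j * P) →
                     ∑ (allFin 3) f * ∑ (allFin 3) g ≤ 9 * P
ternary-inequality f g P h = cases (P <? f₀ * g₀) (P <? f₁ * g₁) (P <? f₂ * g₂)
  where
  open ≤-Reasoning
  f₀ = f zero; f₁ = f (suc zero); f₂ = f (suc (suc zero))
  g₀ = g zero; g₁ = g (suc zero); g₂ = g (suc (suc zero))

  one : ∀ {m} → m ≤ 1 * P → m ≤ P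
  one m≤ = ≤-trans m≤ (≤-reflexive (*-identityˡ P))

  twice : ∀ {m n} → m ≤ P → n ≤ P → m + n ≤ 2 * P
  twice m≤ n≤ = +-mono-≤ m≤ (≤-trans n≤ (≤-reflexive (sym (+-identityʳ P))))

  diagonal : ∀ i j k → P < f i * g i → f i * g i ≤ 4 * P →
             f i * g j ≤ P → f i * g k ≤ P → f j * g i ≤ P → f k * g i ≤ P →
             (f i + (f j + f k)) * (g i + (g j + g k)) ≤ 9 * P
  diagonal i j k P<Q Q≤4P ij ik ji ki = heavy-diagonal (f i) (f j + f k) (g i) (g j + g k) P<Q Q≤4P
    (≤-trans (≤-reflexive (*-distribˡ-+ (f i) (g j) (g k))) (twice ij ik))
    (≤-trans (≤-reflexive (*-distribʳ-+ (g i) (f j) (f k))) (twice ji ki))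

  arrange₀ : ∀ a b c → a + (b + (c + 0)) ≡ a + (b + c)
  arrange₀ = solve-∀
  arrange₁ : ∀ a b c → a + (b + (c + 0)) ≡ b + (a + c)
  arrange₁ = solve-∀
  arrange₂ : ∀ a b c → a + (b + (c + 0)) ≡ c + (a + b)
  arrange₂ = solve-∀

  h₀₁ = one (h zero (suc zero)); h₀₂ = one (h zero (suc (suc zero)))
  h₁₀ = one (h (suc zero) zero); h₁₂ = one (h (suc zero) (suc (suc zero)))
  h₂₀ = one (h (suc (suc zero)) zero); h₂₁ = one (h (suc (suc zero)) (suc zero))

  expand : ∀ a b c x y z → (a + (b + c)) * (x + (y + z)) ≡
           a * x + ((a * y + a * z) + ((b * x + c * x) + ((b * y + c * z) + (b * z + c * y))))
  expand = solve-∀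
  nine : ∀ P → P + (2 * P + (2 * P + (2 * P + 2 * P))) ≡ 9 * P
  nine = solve-∀

  -- A diagonal product above `P` is moved to the front, where `heavy-diagonal` applies; if there is
  -- none, all nine products are at most `P`.
  cases : Dec (P < f₀ * g₀) → Dec (P < f₁ * g₁) → Dec (P < f₂ * g₂) →
          ∑ (allFin 3) f * ∑ (allFin 3) g ≤ 9 * P
  cases (yes p) _ _ = subst (_≤ 9 * P) (sym (cong₂ _*_ (arrange₀ f₀ f₁ f₂) (arrange₀ g₀ g₁ g₂)))
    (diagonal zero (suc zero) (suc (suc zero)) p (h zero zero) h₀₁ h₀₂ h₁₀ h₂₀)
  cases _ (yes p) _ = subst (_≤ 9 * P) (sym (cong₂ _*_ (arrange₁ f₀ f₁ f₂) (arrange₁ g₀ g₁ g₂)))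
    (diagonal (suc zero) zero (suc (suc zero)) p (h (suc zero) (suc zero)) h₁₀ h₁₂ h₀₁ h₂₁)
  cases _ _ (yes p) = subst (_≤ 9 * P) (sym (cong₂ _*_ (arrange₂ f₀ f₁ f₂) (arrange₂ g₀ g₁ g₂)))
    (diagonal (suc (suc zero)) zero (suc zero) p (h (suc (suc zero)) (suc (suc zero))) h₂₀ h₂₁ h₀₂ h₁₂)
  cases (no p₀) (no p₁) (no p₂) = begin
    ∑ (allFin 3) f * ∑ (allFin 3) g
      ≡⟨ cong₂ _*_ (arrange₀ f₀ f₁ f₂) (arrange₀ g₀ g₁ g₂) ⟩
    (f₀ + (f₁ + f₂)) * (g₀ + (g₁ + g₂))
      ≡⟨ expand f₀ f₁ f₂ g₀ g₁ g₂ ⟩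
    f₀ * g₀ + ((f₀ * g₁ + f₀ * g₂) + ((f₁ * g₀ + f₂ * g₀) + ((f₁ * g₁ + f₂ * g₂) + (f₁ * g₂ + f₂ * g₁))))
      ≤⟨ +-mono-≤ (≮⇒≥ p₀) (+-mono-≤ (twice h₀₁ h₀₂) (+-mono-≤ (twice h₁₀ h₂₀)
           (+-mono-≤ (twice (≮⇒≥ p₁) (≮⇒≥ p₂)) (twice h₁₂ h₂₁)))) ⟩
    P + (2 * P + (2 * P + (2 * P + 2 * P)))
      ≡⟨ nine P ⟩
    9 * P ∎

-- Induction on `k`: the slices at first letters `x` and `y` satisfy the hypothesis with `P` scaled
-- by `4 ^ match x y`, and `ternary-inequality` combines the slice sums. There are two functions
-- because slices at different letters get compared, even when `F` and `G` coincide.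
agreement-inequality : ∀ k (F G : Vec (Fin 3) k → ℕ) P →
  (∀ v w → F v * G w ≤ 4 ^ agreements v w * P) →
  ∑ (vecs (allFin 3) k) F * ∑ (vecs (allFin 3) k) G ≤ 9 ^ k * P
agreement-inequality zero    F G P h
  rewrite +-identityʳ (F []) | +-identityʳ (G []) = h [] []
agreement-inequality (suc k) F G P h
  rewrite ∑-vecs (allFin 3) k F | ∑-vecs (allFin 3) k G | *-assoc 9 (9 ^ k) P =
  ternary-inequality (λ x → ∑ (vecs (allFin 3) k) (F ∘ (x ∷_)))
                     (λ y → ∑ (vecs (allFin 3) k) (G ∘ (y ∷_))) (9 ^ k * P) λ x y →
    ≤-trans (agreement-inequality k (F ∘ (x ∷_)) (G ∘ (y ∷_)) (4 ^ match x y * P)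
              (λ v w → ≤-trans (h (x ∷ v) (y ∷ w)) (≤-reflexive (split (match x y) (agreements v w)))))
            (≤-reflexive (swap (9 ^ k) (4 ^ match x y) P))
  where
  swap : ∀ a b c → a * (b * c) ≡ b * (a * c)
  swap = solve-∀
  split : ∀ m n → 4 ^ (m + n) * P ≡ 4 ^ n * (4 ^ m * P)
  split m n = trans (cong (_* P) (^-distribˡ-+-* 4 m n)) (trans (*-assoc (4 ^ m) (4 ^ n) P) (swap (4 ^ m) (4 ^ n) P))

-- Predictors on blocks of three experts

-- On the ballot of w the chosen experts of w say 0 and their block mates say 1.
digit : ∀ {q} → Fin 3 → Fin 3 → Fin (2 + q)
digit y x = if does (x ≟ y) then zero else suc zero

ballot : ∀ {q k} r → Vec (Fin 3) k → Vec (Fin (2 + q)) (k * 3 + r)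
ballot r []      = replicate r zero
ballot r (y ∷ w) = digit y zero ∷ digit y (suc zero) ∷ digit y (suc (suc zero)) ∷ ballot r w

chosen : ∀ {k} r → Vec (Fin 3) k → List (Fin (k * 3 + r))
chosen         r []      = []
chosen {suc k} r (x ∷ v) = (x ↑ˡ (k * 3 + r)) ∷ map (3 ↑ʳ_) (chosen r v)

length-chosen : ∀ {k} r (v : Vec (Fin 3) k) → length (chosen r v) ≡ k
length-chosen r []      = refl
length-chosen r (x ∷ v) = cong suc (trans (length-map (3 ↑ʳ_) (chosen r v)) (length-chosen r v))

lookup-ballot : ∀ {q k} r x y (w : Vec (Fin 3) k) →
                  lookup (ballot {q} r (y ∷ w)) (x ↑ˡ (k * 3 + r)) ≡ digit y x
lookup-ballot r zero             y w = refl
lookup-ballot r (suc zero)       y w = refl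
lookup-ballot r (suc (suc zero)) y w = refl

cost-digit-suc : ∀ {q} x y → cost (digit {q} y x) (suc zero) ≡ match x y
cost-digit-suc x y with does (x ≟ y)
... | true  = refl
... | false = refl

cost-digit-zero : ∀ {q} x → cost (digit {q} x x) zero ≡ 0
cost-digit-zero zero             = refl
cost-digit-zero (suc zero)       = refl
cost-digit-zero (suc (suc zero)) = refl

-- With outcome 1 it is the voters for 0 who err, and on the ballot of `w` a chosen expert of `v`
-- votes 0 just when `w` chooses it too.
cost-chosen-suc : ∀ {q k} r (v w : Vec (Fin 3) k) →
  ∑ (chosen r v) (λ i → cost (lookup (ballot {q} r w) i) (suc zero)) ≡ agreements v w
cost-chosen-suc r []      []      = refl
cost-chosen-suc {q} r (x ∷ v) (y ∷ w) = cong₂ _+_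
  (trans (cong (λ c → cost c (suc zero)) (lookup-ballot {q} r x y w)) (cost-digit-suc x y))
  (trans (∑-map (chosen r v) (3 ↑ʳ_) _) (cost-chosen-suc r v w))

cost-chosen-zero : ∀ {q k} r (v : Vec (Fin 3) k) →
  ∑ (chosen r v) (λ i → cost (lookup (ballot {q} r v) i) zero) ≡ 0
cost-chosen-zero r []      = refl
cost-chosen-zero {q} r (x ∷ v) = cong₂ _+_
  (trans (cong (λ c → cost c zero) (lookup-ballot {q} r x x v)) (cost-digit-zero x))
  (trans (∑-map (chosen r v) (3 ↑ʳ_) _) (cost-chosen-zero r v))

𝟙 : Dec A → ℕ
𝟙 a? = if does a? then 1 else 0

𝟙≡0⇒¬ : (a? : Dec A) → 𝟙 a? ≡ 0 → ¬ A
𝟙≡0⇒¬ (no ¬a) _ = ¬a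

𝟙-product : ∀ c {n} (a? : Dec A) (b? : Dec B) → (A → B → c * c ≤ n) →
            c * 𝟙 a? * (c * 𝟙 b?) ≤ n
𝟙-product c (no _)  _       _ rewrite *-zeroʳ c = z≤n
𝟙-product c (yes _) (no _)  _ rewrite *-zeroʳ c | *-zeroʳ (c * 1) = z≤n
𝟙-product c (yes a) (yes b) h rewrite *-identityʳ c = h a b

m*m≤n*n⇒m≤n : ∀ {m n} → m * m ≤ n * n → m ≤ n
m*m≤n*n⇒m≤n mm≤nn = ≮⇒≥ λ n<m → <⇒≱ (*-mono-< n<m n<m) mm≤nn

^-distribʳ-* : ∀ k m n → (m * n) ^ k ≡ m ^ k * n ^ k
^-distribʳ-* zero    m n = refl
^-distribʳ-* (suc k) m n rewrite ^-distribʳ-* k m n = interchange m n (m ^ k) (n ^ k)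
  where
  interchange : ∀ a b c d → a * b * (c * d) ≡ a * c * (b * d)
  interchange = solve-∀

Predictor : ℕ → ℕ → Set
Predictor q n = Vec (Fin (2 + q)) n → Fin (2 + q)

module _ {q k : ℕ} (r s : ℕ) (g : Predictor q (k * 3 + r)) where

  -- If g errs on the ballot of v when the outcome is 0, the experts of v are all right;
  -- if g says 0 on the ballot of w and the outcome is 1, those shared with w err.
  Fooled : Vec (Fin 3) k → Set
  Fooled v = g (ballot r v) ≢ zero ⊎
             Any (λ w → g (ballot r w) ≡ zero × agreements v w ≤ s) (vecs (allFin 3) k)

  fooled? : ∀ v → Dec (Fooled v)
  fooled? v = ¬? (g (ballot r v) ≟ zero) ⊎-dec
              any? (λ w → (g (ballot r w) ≟ zero) ×-dec (agreements v w ≤? s)) (vecs (allFin 3) k)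

  -- An unfooled `w` gets prediction 0 on its ballot, so few agreements with `v` would make it a
  -- witness for the second alternative of `Fooled v`.
  unfooled-agree : ∀ v w → ¬ Fooled v → ¬ Fooled w → s < agreements v w
  unfooled-agree v w ¬v ¬w = ≰⇒> λ a≤s → ¬v (inj₂ (lose (∈-vecs ∈-allFin w)
    (decidable-stable (g (ballot r w) ≟ zero) (¬w ∘ inj₁) , a≤s)))

  -- Apply `agreement-inequality` with `P = 1` to `c` times the indicator of the unfooled vectors:
  -- two of these agree in more than `s` blocks, which pays for `c * c = 4 ^ suc s`. Then take
  -- square roots.
  unfooled-count : 2 ^ suc s * ∑ (vecs (allFin 3) k) (λ v → 𝟙 (¬? (fooled? v))) ≤ 3 ^ k
  unfooled-count = m*m≤n*n⇒m≤n (begin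
    c * N * (c * N)                                       ≡⟨ cong₂ _*_ cN cN ⟨
    ∑ (vecs (allFin 3) k) F * ∑ (vecs (allFin 3) k) F     ≤⟨ agreement-inequality k F F 1 F*F≤ ⟩
    9 ^ k * 1                                             ≡⟨ *-identityʳ (9 ^ k) ⟩
    (3 * 3) ^ k                                           ≡⟨ ^-distribʳ-* k 3 3 ⟩
    3 ^ k * 3 ^ k                                         ∎)
    where
    open ≤-Reasoning
    c = 2 ^ suc s
    N = ∑ (vecs (allFin 3) k) (λ v → 𝟙 (¬? (fooled? v)))
    F : Vec (Fin 3) k → ℕ
    F v = c * 𝟙 (¬? (fooled? v))
    cN : ∑ (vecs (allFin 3) k) F ≡ c * N
    cN = ∑-*ˡ c (vecs (allFin 3) k) (λ v → 𝟙 (¬? (fooled? v)))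
    F*F≤ : ∀ v w → F v * F w ≤ 4 ^ agreements v w * 1
    F*F≤ v w = 𝟙-product c (¬? (fooled? v)) (¬? (fooled? w)) λ ¬v ¬w → begin
      c * c                    ≡⟨ ^-distribʳ-* (suc s) 2 2 ⟨
      4 ^ suc s                ≤⟨ ^-monoʳ-≤ 4 (unfooled-agree v w ¬v ¬w) ⟩
      4 ^ agreements v w       ≡⟨ *-identityʳ _ ⟨
      4 ^ agreements v w * 1   ∎

-- Union bound over the memory states

bools : List Bool
bools = true ∷ false ∷ []

∈-bools : ∀ b → b ∈ bools
∈-bools true  = here refl
∈-bools false = there (here refl)

-- In each of the `2 ^ s` states at most a fraction `1 / 2 ^ suc s` of the vectors is unfooled, so
-- the bad pairs number at most half of `3 ^ k` and some vector is in none. The number of memory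
-- bits thus doubles as the tolerated number of mistakes per day.
fooled-in-all-states : ∀ {q k} r s (g : Vec Bool s → Predictor q (k * 3 + r)) →
                       ∃[ v ] ∀ m → Fooled r s (g m) v
fooled-in-all-states {q} {k} r s g = v , λ m → decidable-stable (fooled? r s (g m) v)
  (𝟙≡0⇒¬ (¬? (fooled? r s (g m) v)) (∑≡0⇒≡0 (h v) (proj₂ unhit) (∈-vecs ∈-bools m)))
  where
  open ≤-Reasoning
  V = vecs (allFin 3) k
  S = vecs bools s
  h : Vec (Fin 3) k → Vec Bool s → ℕ
  h v m = 𝟙 (¬? (fooled? r s (g m) v))
  H : Vec (Fin 3) k → ℕ
  H v = ∑ S (h v)
  bound : 2 * ∑ V H ≤ 3 ^ k
  bound = *-cancelˡ-≤ (2 ^ s) {{m^n≢0 2 s}} (begin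
    2 ^ s * (2 * ∑ V H)                          ≡⟨ *-assoc (2 ^ s) 2 _ ⟨
    2 ^ s * 2 * ∑ V H                            ≡⟨ cong (_* ∑ V H) (*-comm (2 ^ s) 2) ⟩
    2 ^ suc s * ∑ V H                            ≡⟨ cong (2 ^ suc s *_) (∑-swap V S h) ⟩
    2 ^ suc s * ∑ S (λ m → ∑ V (λ v → h v m))    ≡⟨ ∑-*ˡ (2 ^ suc s) S _ ⟨
    ∑ S (λ m → 2 ^ suc s * ∑ V (λ v → h v m))    ≤⟨ ∑≤length* S (λ m → unfooled-count {k = k} r s (g m)) ⟩
    length S * 3 ^ k                             ≡⟨ cong (_* 3 ^ k) (length-vecs bools s) ⟩
    2 ^ s * 3 ^ k                                ∎)
  H<length : ∑ V H < length V
  H<length = subst (∑ V H <_) (sym (length-vecs (allFin 3) k)) (half< (m^n>0 3 k) bound)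
    where
    half< : ∀ {m n} → 0 < n → 2 * m ≤ n → m < n
    half< {zero}  0<n _    = 0<n
    half< {suc m} _   2m≤n = <-≤-trans (m<m+n (suc m) (s≤s z≤n)) 2m≤n
  unhit : ∃[ v ] H v ≡ 0
  unhit = ∑<length⇒∃≡0 V H H<length
  v : Vec (Fin 3) k
  v = proj₁ unhit

-- Forcing a mistake every day

cost-≢ : ∀ {q} {p o : Fin q} → p ≢ o → cost p o ≡ 1
cost-≢ {p = p} {o} p≢o with p ≟ o
... | yes p≡o = contradiction p≡o p≢o
... | no _    = refl

cost-refl : ∀ {q} (o : Fin q) → cost o o ≡ 0
cost-refl o with o ≟ o
... | yes _  = refl
... | no o≢o = contradiction refl o≢o

bestMistakes≤ : ∀ {q n T} (σ : Stream q n T) i → bestMistakes σ ≤ expertMistakes σ i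
bestMistakes≤ {T = T} σ i =
  All.lookup (min≤xs T (map (expertMistakes σ) (allFin _))) (∈-map⁺ (expertMistakes σ) (∈-allFin i))

module _ {q n s : ℕ} (A : Algorithm (2 + q) n s) where
  open Algorithm A

  -- The experts `W` are fixed in advance, while the adversary, who can simulate the algorithm,
  -- picks the day knowing its memory state.
  Refutable : List (Fin n) → ℕ → Set
  Refutable W d = ∀ m → ∃[ x ] ∃[ o ] (predict m x ≢ o × ∑ W (λ i → cost (lookup x i) o) ≤ d)

  -- Padding that costs no expert anything; mistakes of the algorithm on these days only help the
  -- adversary.
  calm : ∀ u → Stream (2 + q) n u
  calm u = replicate u (replicate n zero , zero)

  expertMistakes-calm : ∀ u i → expertMistakes (calm u) i ≡ 0
  expertMistakes-calm zero    i = refl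
  expertMistakes-calm (suc u) i = cong₂ _+_
    (trans (cong (λ p → cost p zero) (lookup-replicate i zero)) (cost-refl {2 + q} zero))
    (expertMistakes-calm u i)

  -- Following the memory through `update`, the adversary always knows the state whose prediction it
  -- has to refute.
  refuting-stream : ∀ {W d} → Refutable W d → ∀ t u m →
    Σ[ σ ∈ Stream (2 + q) n (t + u) ] (t ≤ mistakesFrom A m σ × ∑ W (expertMistakes σ) ≤ d * t)
  refuting-stream {W} {d} ref zero u m = calm u , z≤n ,
    ≤-trans (≤-reflexive (trans (∑-cong W (expertMistakes-calm u)) (∑-zero W))) z≤n
  refuting-stream {W} {d} ref (suc t) u m with ref m
  ... | x , o , p≢o , cost≤ with refuting-stream {W} {d} ref t u (update m x o)
  ... | σ , t≤ , W≤ = (x , o) ∷ σ , +-mono-≤ (≤-reflexive (sym (cost-≢ p≢o))) t≤ , (begin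
    ∑ W (λ i → cost (lookup x i) o + expertMistakes σ i)    ≡⟨ ∑-+ W _ _ ⟩
    ∑ W (λ i → cost (lookup x i) o) + ∑ W (expertMistakes σ) ≤⟨ +-mono-≤ cost≤ W≤ ⟩
    d + d * t                                               ≡⟨ *-suc d t ⟨
    d * suc t                                               ∎)
    where open ≤-Reasoning

  -- With a single memory state the prediction on a fixed split vote never changes, so an expert on
  -- the other side can be made right every day. This rules out `s = 0` before any division by `s`.
  single-refutable : 2 ≤ n → s ≡ 0 → ∃[ i ] Refutable (i ∷ []) 0
  single-refutable (s≤s (s≤s _)) refl with predict [] (zero ∷ replicate _ (suc zero)) in eq
  ... | zero  = suc zero , λ { [] → zero ∷ replicate _ (suc zero) , suc zero ,
                 (λ p → contradiction (trans (sym eq) p) λ ()) , z≤n }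
  ... | suc _ = zero , λ { [] → zero ∷ replicate _ (suc zero) , zero ,
                 (λ p → contradiction (trans (sym eq) p) λ ()) , z≤n }

  -- Experts 0 and 1 vote 0 and 1; a vote that differs from the prediction is made the outcome, and
  -- only the other expert of the pair errs.
  pair-refutable : 2 ≤ n → Σ[ W ∈ List (Fin n) ] (length W ≡ 2 × Refutable W 1)
  pair-refutable (s≤s (s≤s _)) = zero ∷ suc zero ∷ [] , refl , go
    where
    go : Refutable (zero ∷ suc zero ∷ []) 1
    go m with predict m (zero ∷ replicate _ (suc zero)) in eq
    ... | zero  = _ , suc zero , (λ p → contradiction (trans (sym eq) p) λ ()) , ≤-refl
    ... | suc _ = _ , zero , (λ p → contradiction (trans (sym eq) p) λ ()) , ≤-refl

-- The alternatives of `Fooled` become the two kinds of day: the ballot of `v` with outcome 0, or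
-- the ballot of the witness `w` with outcome 1.
blocks-refutable : ∀ {q n s} k r → n ≡ k * 3 + r → (A : Algorithm (2 + q) n s) →
                   Σ[ W ∈ List (Fin n) ] (length W ≡ k × Refutable A W s)
blocks-refutable {s = s} k r refl A with fooled-in-all-states {k = k} r s (Algorithm.predict A)
... | v , fooled = chosen r v , length-chosen r v , λ m → day m (fooled m)
  where
  day : ∀ m → Fooled r s (Algorithm.predict A m) v → _
  day m (inj₁ p≢0) = ballot r v , zero , p≢0 , ≤-trans (≤-reflexive (cost-chosen-zero r v)) z≤n
  day m (inj₂ w∈) with find w∈
  ... | w , _ , p≡0 , a≤s = ballot r w , suc zero ,
        (λ p≡1 → contradiction (trans (sym p≡0) p≡1) λ ()) ,
        ≤-trans (≤-reflexive (cost-chosen-suc r v w)) a≤s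

-- Natural numbers among the rationals

-- Division normalizes through a gcd that is stuck at a variable; the explicit reduced form lets
-- rational arithmetic and order compute.
ι≡mkℚ : ∀ m → ι m ≡ ℚ.mkℚ (+ m) 0 (coprime-sym (1-coprimeTo m))
ι≡mkℚ m = ℚ.normalize-coprime (coprime-sym (1-coprimeTo m))

ι-+ : ∀ m n → ι (m + n) ≡ ι m ℚ.+ ι n
ι-+ m n rewrite ι≡mkℚ m | ι≡mkℚ n =
  cong (ℚ._/ 1) (cong₂ ℤ._+_ (sym (ℤ.*-identityʳ (+ m))) (sym (ℤ.*-identityʳ (+ n))))

ι-* : ∀ m n → ι (m * n) ≡ ι m ℚ.* ι n
ι-* m n rewrite ι≡mkℚ m | ι≡mkℚ n = cong (ℚ._/ 1) (ℤ.pos-* m n)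

ι-mono-≤ : ∀ {m n} → m ≤ n → ι m ℚ.≤ ι n
ι-mono-≤ {m} {n} m≤n rewrite ι≡mkℚ m | ι≡mkℚ n =
  ℚ.*≤* (ℤ.*-monoʳ-≤-nonNeg (+ 1) (ℤ.+≤+ m≤n))

ι-cancel : ∀ b e {ρ} → ι (b + e) ℚ.≤ ι b ℚ.+ ρ → ι e ℚ.≤ ρ
ι-cancel b e {ρ} le = ℚ.≮⇒≥ λ ρ<e →
  ℚ.<-irrefl refl (ℚ.<-≤-trans (ℚ.+-monoʳ-< (ι b) ρ<e) (subst (ℚ._≤ ι b ℚ.+ ρ) (ι-+ b e) le))

-- The lower bound

few-blocks-arithmetic : ∀ n s M → n / 3 < 2 * s → n * M ≤ 16 * (s * M)
few-blocks-arithmetic n s M k<2s = begin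
  n * M            ≤⟨ *-monoˡ-≤ M n≤16s ⟩
  16 * s * M       ≡⟨ *-assoc 16 s M ⟩
  16 * (s * M)     ∎
  where
  open ≤-Reasoning
  six : ∀ s → 2 * s * 3 ≡ 6 * s
  six = solve-∀
  n≤16s : n ≤ 16 * s
  n≤16s = begin
    n                        ≡⟨ m≡m%n+[m/n]*n n 3 ⟩
    n % 3 + n / 3 * 3        ≤⟨ +-monoˡ-≤ (n / 3 * 3) (<⇒≤ (m%n<n n 3)) ⟩
    suc (n / 3) * 3          ≤⟨ *-monoˡ-≤ 3 k<2s ⟩
    2 * s * 3                ≡⟨ six s ⟩
    -- Weakened to the constant 16 that the case of many blocks produces.
    6 * s                    ≤⟨ *-monoˡ-≤ s (m≤m+n 6 10) ⟩
    16 * s                   ∎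

-- The constant 16 is `4 * 2 * 2`: `n ≤ 4 * k` because `k ≥ 2` covers the remainder modulo 3,
-- rounding down to `t ≥ 1` loses at most a factor 2, and `t ≤ 2 * e`.
many-blocks-arithmetic : ∀ n s M .{{_ : NonZero s}} .{{_ : NonZero M}} → 2 * s ≤ n / 3 →
                         ∀ e → n / 3 * M / s ≤ e + e → n * M ≤ 16 * (s * e)
many-blocks-arithmetic n s M 2s≤k e t≤2e = begin
  n * M                                 ≤⟨ *-monoˡ-≤ M n≤4k ⟩
  4 * k * M                             ≡⟨ *-assoc 4 k M ⟩
  4 * (k * M)                           ≤⟨ *-monoʳ-≤ 4 kM≤2ts ⟩
  4 * (t * s + t * s)                   ≤⟨ *-monoʳ-≤ 4 (+-mono-≤ (*-monoˡ-≤ s t≤2e) (*-monoˡ-≤ s t≤2e)) ⟩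
  4 * ((e + e) * s + (e + e) * s)       ≡⟨ sixteen e s ⟩
  16 * (s * e)                          ∎
  where
  open ≤-Reasoning
  sixteen : ∀ e s → 4 * ((e + e) * s + (e + e) * s) ≡ 16 * (s * e)
  sixteen = solve-∀
  k = n / 3
  t = k * M / s
  2≤k : 2 ≤ k
  2≤k = ≤-trans (*-monoʳ-≤ 2 (>-nonZero⁻¹ s)) 2s≤k
  s≤kM : s ≤ k * M
  s≤kM = ≤-trans (m≤m+n s (s + 0)) (≤-trans 2s≤k (m≤m*n k M))
  n≤4k : n ≤ 4 * k
  n≤4k = begin
    n                ≡⟨ m≡m%n+[m/n]*n n 3 ⟩
    n % 3 + k * 3    ≤⟨ +-monoˡ-≤ (k * 3) (≤-trans (s≤s⁻¹ (m%n<n n 3)) 2≤k) ⟩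
    k + k * 3        ≡⟨ cong (_+_ k) (*-comm k 3) ⟩
    4 * k            ∎
  kM≤2ts : k * M ≤ t * s + t * s
  kM≤2ts = begin
    k * M                  ≡⟨ m≡m%n+[m/n]*n (k * M) s ⟩
    (k * M) % s + t * s    ≤⟨ +-monoˡ-≤ (t * s) (<⇒≤ (m%n<n (k * M) s)) ⟩
    s + t * s              ≤⟨ +-monoˡ-≤ (t * s) (m≤n*m s t {{>-nonZero (m≥n⇒m/n>0 s≤kM)}}) ⟩
    t * s + t * s          ∎

-- Consequences of the regret guarantee

module _ {q n s T M : ℕ} {R : ℚ} (A : Algorithm (2 + q) n s) (regret : AchievesRegret A T M R) where

  private
    ρ : ℚ
    ρ = R ℚ.* ι T

  -- The best expert does no worse than the average over `W`, hence makes at most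
  -- `d * t / length W ≤ M` mistakes, and the regret guarantee applies to the refuting stream.
  forced-days : ∀ W d {t} .{{_ : NonZero (length W)}} → Refutable A W d → t ≤ T →
                d * t ≤ length W * M →
                ∃[ b ] (b ≤ M × length W * b ≤ d * t × ι t ℚ.≤ ι b ℚ.+ ρ)
  forced-days W d {t} ref t≤T dt≤ = bestMistakes σ , b≤M , b≤dt ,
    ℚ.≤-trans (ι-mono-≤ (proj₁ (proj₂ forced))) (regret σ b≤M)
    where
    forced : Σ[ σ ∈ Stream (2 + q) n T ] (t ≤ mistakes A σ × ∑ W (expertMistakes σ) ≤ d * t)
    forced = subst (λ T → Σ[ σ ∈ Stream (2 + q) n T ] (t ≤ mistakes A σ × ∑ W (expertMistakes σ) ≤ d * t))
      (m+[n∸m]≡n t≤T) (refuting-stream A {W} {d} ref t (T ∸ t) (Algorithm.start A))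
    σ : Stream (2 + q) n T
    σ = proj₁ forced
    b≤dt : length W * bestMistakes σ ≤ d * t
    b≤dt = ≤-trans (length*≤∑ W (bestMistakes≤ σ)) (proj₂ (proj₂ forced))
    b≤M : bestMistakes σ ≤ M
    b≤M = *-cancelˡ-≤ (length W) (≤-trans b≤dt dt≤)

  module _ (M+ρ<T : ι M ℚ.+ ρ ℚ.< ι T) where

    -- Otherwise mistakes could be forced on all `T` days while the best expert stays within `M`,
    -- contradicting `M+ρ<T`. This ensures that the shorter attacks below fit into `T` days.
    budget<T : ∀ W d .{{_ : NonZero (length W)}} → Refutable A W d → length W * M < d * T
    budget<T W d ref = ≰⇒> λ dT≤ → absurd (forced-days W d ref ≤-refl dT≤)
      where
      absurd : ∃[ b ] (b ≤ M × length W * b ≤ d * T × ι T ℚ.≤ ι b ℚ.+ ρ) → _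
      absurd (b , b≤M , _ , T≤) =
        ℚ.<-irrefl refl (ℚ.<-≤-trans M+ρ<T (ℚ.≤-trans T≤ (ℚ.+-monoˡ-≤ ρ (ι-mono-≤ b≤M))))

    s≢0 : 2 ≤ n → s ≢ 0
    s≢0 2≤n s≡0 with single-refutable A 2≤n s≡0
    ... | i , ref = contradiction (budget<T (i ∷ []) 0 ref) λ ()

    -- Attack for `2 * M` days with two experts who disagree: the algorithm errs on each of them,
    -- the better of the two experts at most `M` times.
    M≤ρ : 2 ≤ n → ι M ℚ.≤ ρ
    M≤ρ 2≤n with pair-refutable A 2≤n
    ... | W@(_ ∷ _) , len , ref = go (forced-days W 1 ref 2M≤T (≤-reflexive (trans (*-identityˡ _) len*M)))
      where
      len*M : 2 * M ≡ length W * M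
      len*M = cong (_* M) (sym len)
      2M≤T : 2 * M ≤ T
      2M≤T = ≤-trans (≤-reflexive len*M) (≤-trans (<⇒≤ (budget<T W 1 ref)) (≤-reflexive (*-identityˡ T)))
      go : ∃[ b ] (b ≤ M × length W * b ≤ 1 * (2 * M) × ι (2 * M) ℚ.≤ ι b ℚ.+ ρ) → ι M ℚ.≤ ρ
      go (b , b≤M , _ , 2M≤) = ι-cancel M M (subst (λ m → ι m ℚ.≤ ι M ℚ.+ ρ) (cong (_+_ M) (+-identityʳ M))
        (ℚ.≤-trans 2M≤ (ℚ.+-monoˡ-≤ ρ (ι-mono-≤ b≤M))))

    few-blocks-excess : 2 ≤ n → n / 3 < 2 * s → ∃[ e ] (ι e ℚ.≤ ρ × n * M ≤ 16 * (s * e))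
    few-blocks-excess 2≤n k<2s = M , M≤ρ 2≤n , few-blocks-arithmetic n s M k<2s

    many-blocks-excess : .{{_ : NonZero M}} .{{_ : NonZero s}} → 2 * s ≤ n / 3 →
                         ∃[ e ] (ι e ℚ.≤ ρ × n * M ≤ 16 * (s * e))
    many-blocks-excess 2s≤k = go (blocks-refutable k (n % 3)
        (trans (m≡m%n+[m/n]*n n 3) (+-comm (n % 3) (n / 3 * 3))) A)
      where
      open ≤-Reasoning
      k = n / 3
      t = k * M / s
      st≤kM : s * t ≤ k * M
      st≤kM = ≤-trans (≤-reflexive (*-comm s t)) (m/n*n≤m (k * M) s)
      k≢0 : NonZero k
      k≢0 = >-nonZero (≤-trans (m≤n*m 1 2) (≤-trans (*-monoʳ-≤ 2 (>-nonZero⁻¹ s)) 2s≤k))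
      go : Σ[ W ∈ List (Fin n) ] (length W ≡ k × Refutable A W s) →
           ∃[ e ] (ι e ℚ.≤ ρ × n * M ≤ 16 * (s * e))
      go (W , len , ref) = finish (forced-days W s {{W≢0}} ref t≤T st≤WM)
        where
        W≢0 : NonZero (length W)
        W≢0 = subst NonZero (sym len) k≢0
        st≤WM : s * t ≤ length W * M
        st≤WM = subst (λ l → s * t ≤ l * M) (sym len) st≤kM
        t≤T : t ≤ T
        t≤T = *-cancelˡ-≤ s (≤-trans st≤WM (<⇒≤ (budget<T W s {{W≢0}} ref)))
        finish : ∃[ b ] (b ≤ M × length W * b ≤ s * t × ι t ℚ.≤ ι b ℚ.+ ρ) →
                 ∃[ e ] (ι e ℚ.≤ ρ × n * M ≤ 16 * (s * e))
        finish (b , _ , Wb≤st , t≤b+ρ) =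
          -- The forced excess over the best expert. As `length W = k ≥ 2 * s`, averaging gives
          -- `2 * b ≤ t`, so it is at least half of `t`.
          t ∸ b ,
          ι-cancel b (t ∸ b) (ℚ.≤-trans (ℚ.≤-reflexive (cong ι (m+[n∸m]≡n b≤t))) t≤b+ρ) ,
          many-blocks-arithmetic n s M 2s≤k (t ∸ b) (begin
            t              ≡⟨ m+[n∸m]≡n b≤t ⟨
            b + (t ∸ b)    ≤⟨ +-monoˡ-≤ (t ∸ b) b≤t∸b ⟩
            (t ∸ b) + (t ∸ b) ∎)
          where
          shuffle : ∀ s b → s * (b + b) ≡ 2 * s * b
          shuffle = solve-∀
          2b≤t : b + b ≤ t
          2b≤t = *-cancelˡ-≤ s (begin
            s * (b + b)     ≡⟨ shuffle s b ⟩
            2 * s * b       ≤⟨ *-monoˡ-≤ b 2s≤k ⟩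
            k * b           ≡⟨ cong (_* b) len ⟨
            length W * b    ≤⟨ Wb≤st ⟩
            s * t           ∎)
          b≤t : b ≤ t
          b≤t = ≤-trans (m≤m+n b b) 2b≤t
          b≤t∸b : b ≤ t ∸ b
          b≤t∸b = ≤-trans (≤-reflexive (sym (m+n∸n≡m b b))) (∸-monoˡ-≤ b 2b≤t)

    excess : 2 ≤ n → .{{_ : NonZero M}} → ∃[ e ] (ι e ℚ.≤ ρ × n * M ≤ 16 * (s * e))
    excess 2≤n = [ many-blocks-excess {{it}} {{≢-nonZero (s≢0 2≤n)}} , few-blocks-excess 2≤n ]′
      (≤-<-connex (2 * s) (n / 3))

    space-bound : 2 ≤ n → 0ℚ ℚ.≤ ρ → (+ 1 ℚ./ 16) ℚ.* ι (n * M) ℚ.≤ ι s ℚ.* ρ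
    space-bound 2≤n 0≤ρ = go (bound M refl)
      where
      open ℚ.≤-Reasoning
      c : ℚ
      c = + 1 ℚ./ 16
      bound : ∀ m → m ≡ M → ∃[ e ] (ι e ℚ.≤ ρ × n * M ≤ 16 * (s * e))
      -- The case `M = 0` is split off because the attack length `k * M / s` has to be positive in
      -- `excess`; here both sides of the bound on `n * M` vanish.
      bound zero    refl = 0 , 0≤ρ , ≤-trans (≤-reflexive (*-zeroʳ n)) z≤n
      bound (suc _) refl = excess 2≤n
      go : ∃[ e ] (ι e ℚ.≤ ρ × n * M ≤ 16 * (s * e)) → c ℚ.* ι (n * M) ℚ.≤ ι s ℚ.* ρ
      go (e , e≤ρ , nM≤) = begin
        c ℚ.* ι (n * M)             ≤⟨ ℚ.*-monoˡ-≤-nonNeg c (ι-mono-≤ nM≤) ⟩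
        c ℚ.* ι (16 * (s * e))      ≡⟨ cong (c ℚ.*_) (ι-* 16 (s * e)) ⟩
        c ℚ.* (ι 16 ℚ.* ι (s * e))  ≡⟨ ℚ.*-assoc c (ι 16) (ι (s * e)) ⟨
        ℚ.1ℚ ℚ.* ι (s * e)          ≡⟨ ℚ.*-identityˡ (ι (s * e)) ⟩
        ι (s * e)                   ≡⟨ ι-* s e ⟩
        ι s ℚ.* ι e                 ≤⟨ ℚ.*-monoˡ-≤-nonNeg (ι s) {{ℚ.normalize-nonNeg s 1}} e≤ρ ⟩
        ι s ℚ.* ρ                   ∎

theorem1p1 : ∀ (q : ℕ) → 2 ≤ q →
    Σ[ c ∈ ℚ ] (0ℚ ℚ.< c ×
    (∀ (n : ℕ → ℕ) → n ∈o (λ T → 2 ^ T) →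
    Σ[ T₀ ∈ ℕ ] (∀ T → T₀ ≤ T → 2 ≤ n T →
    ∀ (M : ℕ) (R : ℚ) → 0ℚ ℚ.≤ R → ι M ℚ.+ R ℚ.* ι T ℚ.< ι T →
    ∀ (s : ℕ) (A : Algorithm q (n T) s) → AchievesRegret A T M R →
    c ℚ.* ι (n T * M) ℚ.≤ ι s ℚ.* (R ℚ.* ι T))))
theorem1p1 (suc (suc q)) (s≤s (s≤s _)) = + 1 ℚ./ 16 , ℚ.positive⁻¹ (+ 1 ℚ./ 16) , λ n _ → 0 ,
  λ T _ 2≤n M R 0≤R M+RT<T s A regret → space-bound {R = R} A regret M+RT<T 2≤n
    (subst (ℚ._≤ R ℚ.* ι T) (ℚ.*-zeroˡ (ι T))
      (ℚ.*-monoʳ-≤-nonNeg (ι T) {{ℚ.normalize-nonNeg T 1}} 0≤R))
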